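{- Let $k \ge 1$ be an integer and let $G$ be a $k$-degenerate graph with maximum degree $\Delta$, where $k \le \Delta$. Then $\chi_s'(G) \le (4k-2)\Delta - 2k^2 + 1$.
   Context: All graphs are finite and simple. A graph is $k$-degenerate if every subgraph of it has a vertex of degree at most $k$. A strong edge coloring of $G$ is an assignment of colors to the edges of $G$ such that every path with three edges receives three distinct colors; equivalently, any two distinct edges that share an endpoint, or that are both incident with a common edge (i.e., an endpoint of one is adjacent to an endpoint of the other), receive different colors. The strong chromatic index $\chi_s'(G)$ is the minimum number of colors in a strong edge coloring of $G$. -}

module Defs where

open import Data.Bool.Base using (Bool; false; T)
open import Data.Bool.Properties using (T?; T-irrelevant)
open import Data.Fin.Base using (Fin; zero; _<_; combine; remQuot; finToFun; funToFin)
open import Data.Fin.Properties using (_≟_; _<?_; <-irrelevant; any?; all?; combine-injective; remQuot-combine; combine-remQuot; finToFun-funToFin)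
open import Data.Fin.Subset using (Subset; _∈_; Nonempty; ∣_∣)
open import Data.Nat.Base using (ℕ; zero; suc; _*_; _^_; _≤_; _⊔_; z≤n; s≤s)
open import Data.Product.Base using (Σ; ∃; ∃₂; _×_; _,_; proj₁; proj₂)
open import Data.Sum.Base using (_⊎_)
open import Data.Vec.Base using (tabulate)
import Data.Vec.Functional as Vector
open import Function.Base using (_∘_)
open import Relation.Nullary.Decidable using (Dec; yes; no; ¬?; _×-dec_; _⊎-dec_; _→-dec_; map′)
open import Relation.Nullary.Negation using (contradiction)
open import Relation.Binary.PropositionalEquality using (_≡_; _≢_; refl; sym; trans; cong; cong₂; subst)

record Graph (n : ℕ) : Set where
  field
    adj        : Fin n → Fin n → Bool
    adj-sym    : ∀ u v → adj u v ≡ adj v u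
    adj-irrefl : ∀ v → adj v v ≡ false

open Graph public

Adj : ∀ {n} → Graph n → Fin n → Fin n → Set
Adj G u v = T (adj G u v)

degree : ∀ {n} → Graph n → Fin n → ℕ
degree G v = ∣ tabulate (adj G v) ∣

-- The graph without vertices gets maximum degree 0.
maxDegree : ∀ {n} → Graph n → ℕ
maxDegree G = Vector.foldr _⊔_ 0 (degree G)

-- A not necessarily induced subgraph (V(H), E(H)) of G.  The field `graph`
-- is E(H) regarded as a graph on all of Fin n, so that `degree graph v` is
-- the degree of v in H for every v ∈ V(H).  By symmetry, `endpoint` puts
-- both ends of each edge of H in V(H).
record Subgraph {n} (G : Graph n) : Set where
  field
    vertices : Subset n
    graph    : Graph n
    endpoint : ∀ {u v} → Adj graph u v → u ∈ vertices
    included : ∀ {u v} → Adj graph u v → Adj G u v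

-- As usual, "every subgraph" means every subgraph with at least one vertex.
Degenerate : ∀ {n} → ℕ → Graph n → Set
Degenerate k G = (H : Subgraph G) → let open Subgraph H in
  Nonempty vertices → ∃ λ v → v ∈ vertices × degree graph v ≤ k

-- Each undirected edge is represented once, by its endpoints in increasing
-- order; the two proof fields are propositionally irrelevant, so that _≡_ is
-- equality of edges (see code-injective).
record Edge {n} (G : Graph n) : Set where
  constructor edge
  field
    src tgt  : Fin n
    src<tgt  : src < tgt
    adjacent : Adj G src tgt

open Edge public

module _ {n} {G : Graph n} where

  Incident : Fin n → Edge G → Set
  Incident v e = v ≡ src e ⊎ v ≡ tgt e

  ShareEndpoint : Edge G → Edge G → Set
  ShareEndpoint e f = ∃ λ v → Incident v e × Incident v f

  Joined : Edge G → Edge G → Set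
  Joined e f = ∃₂ λ u v → Incident u e × Incident v f × Adj G u v

  IsStrongEdgeColoring : ∀ {m} → (Edge G → Fin m) → Set
  IsStrongEdgeColoring c =
    ∀ e f → e ≢ f → ShareEndpoint e f ⊎ Joined e f → c e ≢ c f

StronglyColorable : ∀ {n} → Graph n → ℕ → Set
StronglyColorable G m = Σ (Edge G → Fin m) IsStrongEdgeColoring

IsStrongChromaticIndex : ∀ {n} → Graph n → ℕ → Set
IsStrongChromaticIndex G χ =
  StronglyColorable G χ × (∀ m → StronglyColorable G m → χ ≤ m)

-- The minimum exists: colorability with m colors is decidable, and giving
-- every edge its own color uses at most n * n colors.

module _ {n} {G : Graph n} where

  code : Edge G → Fin (n * n)
  code e = combine (src e) (tgt e)

  code-injective : ∀ e f → code e ≡ code f → e ≡ f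
  code-injective (edge s t p a) (edge s′ t′ q b) eq
    with refl , refl ← combine-injective s t s′ t′ eq
    = cong₂ (edge s t) (<-irrelevant p q) (T-irrelevant a b)

  edgeAt? : ∀ i → Dec (∃ λ (e : Edge G) → code e ≡ i)
  edgeAt? i = map′
    (λ (p , a) → edge _ _ p a , combine-remQuot {n} n i)
    (λ { (e , refl) → subst (λ (s , t) → s < t × Adj G s t)
           (sym (remQuot-combine (src e) (tgt e))) (src<tgt e , adjacent e) })
    (let (s , t) = remQuot {n} n i in (s <? t) ×-dec T? (adj G s t))

  allEdges? : {P : Edge G → Set} → (∀ e → Dec (P e)) → Dec (∀ e → P e)
  allEdges? {P} P? = map′ (λ h e → h (code e) e refl) (λ h _ e _ → h e) (all? at?)
    where
    at? : ∀ i → Dec (∀ e → code e ≡ i → P e)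
    at? i with edgeAt? i
    ... | no ∄e = yes λ e eq → contradiction (e , eq) ∄e
    ... | yes (e₀ , refl) = map′
      (λ p e eq → subst P (sym (code-injective e e₀ eq)) p)
      (λ h → h e₀ refl)
      (P? e₀)

  incident? : ∀ v (e : Edge G) → Dec (Incident v e)
  incident? v e = (v ≟ src e) ⊎-dec (v ≟ tgt e)

  edge≟ : (e f : Edge G) → Dec (e ≡ f)
  edge≟ e f = map′ (code-injective e f) (cong code) (code e ≟ code f)

  isStrongEdgeColoring? : ∀ {m} (c : Edge G → Fin m) → Dec (IsStrongEdgeColoring c)
  isStrongEdgeColoring? c = allEdges? λ e → allEdges? λ f →
    ¬? (edge≟ e f) →-dec (
      (any? (λ v → incident? v e ×-dec incident? v f)
       ⊎-dec
       any? (λ u → any? λ v → incident? u e ×-dec incident? v f ×-dec T? (adj G u v)))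
      →-dec ¬? (c e ≟ c f))

  strong-resp : ∀ {m} {c d : Edge G → Fin m} → (∀ e → c e ≡ d e) →
                IsStrongEdgeColoring c → IsStrongEdgeColoring d
  strong-resp c≗d strong e f e≢f near de≡df =
    strong e f e≢f near (trans (c≗d e) (trans de≡df (sym (c≗d f))))

  code-strong : IsStrongEdgeColoring code
  code-strong e f e≢f _ eq = e≢f (code-injective e f eq)

stronglyColorable? : ∀ {n} (G : Graph n) m → Dec (StronglyColorable G m)
stronglyColorable? G zero = map′
  (λ ∄e → (λ e → contradiction e ∄e) , λ e → contradiction e ∄e)
  (λ (c , _) e → contradiction (c e) λ ())
  (allEdges? λ _ → no λ ())
stronglyColorable? {n} G (suc m) = map′
  (λ (i , strong) → finToFun i ∘ code , strong)
  (λ (c , strong) → funToFin (extend c) ,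
     strong-resp (λ e → sym (trans (finToFun-funToFin (extend c) (code e)) (extend-code c e))) strong)
  (any? {n = suc m ^ (n * n)} λ i → isStrongEdgeColoring? (finToFun i ∘ code))
  where
  extend : (Edge G → Fin (suc m)) → Fin (n * n) → Fin (suc m)
  extend c i with edgeAt? {G = G} i
  ... | yes (e , _) = c e
  ... | no _        = zero

  extend-code : ∀ c e → extend c (code e) ≡ c e
  extend-code c e with edgeAt? {G = G} (code e)
  ... | yes (e′ , eq) = cong c (code-injective e′ e eq)
  ... | no ∄e         = contradiction (e , refl) ∄e

minimum : {P : ℕ → Set} → (∀ m → Dec (P m)) → ∀ N → P N →
          ∃ λ m → P m × (∀ j → P j → m ≤ j)
minimum P? N pN with P? 0
... | yes p₀ = 0 , p₀ , λ _ _ → z≤n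
minimum P? zero    pN | no ¬p₀ = contradiction pN ¬p₀
minimum P? (suc N) pN | no ¬p₀ with m , pm , least ← minimum (P? ∘ suc) N pN
  = suc m , pm , λ { zero p₀ → contradiction p₀ ¬p₀ ; (suc j) pj → s≤s (least j pj) }

strongChromaticIndex-exists : ∀ {n} (G : Graph n) → ∃ (IsStrongChromaticIndex G)
strongChromaticIndex-exists {n} G =
  minimum (stronglyColorable? G) (n * n) (code , code-strong)

strongChromaticIndex : ∀ {n} → Graph n → ℕ
strongChromaticIndex G = proj₁ (strongChromaticIndex-exists G)

strongChromaticIndex-correct : ∀ {n} (G : Graph n) →
  IsStrongChromaticIndex G (strongChromaticIndex G)
strongChromaticIndex-correct G = proj₂ (strongChromaticIndex-exists G)

{-# OPTIONS --safe #-}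

-- Colour the edges greedily, in the reverse of an order in which they are
-- deleted one at a time.  From the current graph H ⊆ G delete an edge vw such
-- that deg_H w ≤ k and at most k of the H-neighbours of v have H-degree above
-- k: take v of degree at most k in the subgraph of H induced by the vertices
-- of H-degree above k, and w a neighbour of v outside it.
--
-- Call a G-neighbour x of u heavy if ux ∈ H or deg_H x ≥ k.  At every stage,
-- each vertex u has at most k heavy neighbours, or all of them are
-- H-neighbours of u.  When vw is coloured, its conflicts (through G) with the
-- edges of H are therefore among
--   * the H-edges at the at most Δ − 1 other G-neighbours of w, of which at
--     most k − 1 are heavy and the others have H-degree at most k − 1, and
--   * the H-edges at the at most Δ − 1 other G-neighbours of v, of which at
--     most k have H-degree above k.
-- These are at most (k−1)(Δ−1) + (k−1)(Δ−k+1) + k(Δ−1) + k(Δ−k)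
-- = (4k−2)Δ − 2k² edges.
module Submission where

open import Defs
open import Data.Nat.Base as ℕ using (ℕ)
open import Data.Integer.Base using (+_; _+_; _-_; _*_; _^_; _≤_)

open import Data.Bool.Base using (true; false; T; if_then_else_)
open import Data.Bool.Properties using (T?; T-≡)
open import Data.Fin.Base as Fin using (Fin; combine; remQuot)
open import Data.Fin.Properties as Fin using (_≟_; any?; pigeonhole; remQuot-combine)
open import Data.Fin.Subset using (Subset; ∣_∣) renaming (_∈_ to _∈ₛ_)
open import Data.Fin.Subset.Properties using (p⊆q⇒∣p∣≤∣q∣; p⊂q⇒∣p∣<∣q∣)
open import Data.Integer.Base using (ℤ; +≤+)
open import Data.Integer.Properties using (pos-*)
open import Data.Integer.Tactic.RingSolver using (solve-∀)
open import Data.List.Base as List using (List; []; _∷_; _++_; length; map; filter; concatMap; allFin)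
open import Data.List.Membership.Propositional using (_∈_; _∉_; lose)
open import Data.List.Membership.Propositional.Properties using (∈-concatMap⁺; ∈-filter⁺; ∈-map⁺; ∈-allFin; ∈-++⁺ˡ; ∈-++⁺ʳ)
import Data.List.Membership.DecPropositional as DecMembership
open import Data.List.Properties using (length-++; length-map)
open import Data.List.Relation.Unary.Any using (index)
open import Data.List.Relation.Unary.Any.Properties using (lookup-index)
open import Data.Nat.Induction using (<-wellFounded)
open import Data.Nat.Properties as ℕ using (m≤m+n; m≤n+m; ≤-refl; ≤-trans; ≤-reflexive; <⇒≤; ≮⇒≥; <-≤-trans)
open import Algebra.Properties.CommutativeSemigroup ℕ.+-commutativeSemigroup using (interchange)
open import Data.Product.Base using (∃; ∃₂; _×_; _,_; proj₁; proj₂; uncurry)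
open import Data.Sum.Base as Sum using (_⊎_; inj₁; inj₂; [_,_]′)
open import Data.Vec.Base using (tabulate)
open import Data.Vec.Properties using (lookup∘tabulate; lookup⇒[]=; []=⇒lookup)
import Data.Vec.Functional as Vector
open import Function.Base using (_∘_; id)
open import Function.Bundles using (Equivalence; mk⇔)
open import Induction.WellFounded using (Acc; acc)
open import Relation.Binary.PropositionalEquality using (_≡_; _≢_; refl; sym; trans; cong; cong₂; subst; subst₂)
open import Relation.Nullary.Decidable using (Dec; yes; no; does; _×-dec_; _⊎-dec_; ¬?; dec-true; dec-false; does-⇔; decidable-stable)
open import Relation.Nullary.Negation using (¬_; contradiction)
open import Relation.Unary using (Decidable)

-- Counting

does⁻ : ∀ {A : Set} (A? : Dec A) → T (does A?) → A
does⁻ (yes a) _ = a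

does⁺ : ∀ {A : Set} (A? : Dec A) → A → T (does A?)
does⁺ A? a = Equivalence.from T-≡ (dec-true A? a)

module _ {n} {P : Fin n → Set} (P? : Decidable P) where

  select : Subset n
  select = tabulate (does ∘ P?)

  count : ℕ
  count = ∣ select ∣

  ∈-select⁺ : ∀ {x} → P x → x ∈ₛ select
  ∈-select⁺ {x} p = lookup⇒[]= x select (trans (lookup∘tabulate _ x) (dec-true (P? x) p))

  ∈-select⁻ : ∀ {x} → x ∈ₛ select → P x
  ∈-select⁻ {x} x∈ = does⁻ (P? x) (Equivalence.from T-≡ (trans (sym (lookup∘tabulate _ x)) ([]=⇒lookup x∈)))

module _ {n} {P Q : Fin n → Set} (P? : Decidable P) (Q? : Decidable Q) where

  count-mono : (∀ {x} → P x → Q x) → count P? ℕ.≤ count Q?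
  count-mono P⊆Q = p⊆q⇒∣p∣≤∣q∣ (∈-select⁺ Q? ∘ P⊆Q ∘ ∈-select⁻ P?)

  count-strict : ∀ x → (∀ {y} → P y → Q y) → Q x → ¬ P x → count P? ℕ.< count Q?
  count-strict x P⊆Q q ¬p =
    p⊂q⇒∣p∣<∣q∣ (∈-select⁺ Q? ∘ P⊆Q ∘ ∈-select⁻ P? , x , ∈-select⁺ Q? q , ¬p ∘ ∈-select⁻ P?)

-- Generalising from `allFin` to an arbitrary `f` lets the induction pass to the tail `f ∘ Fin.suc`.
length-filter-tabulate : ∀ {m n} {P : Fin m → Set} (P? : Decidable P) (f : Fin n → Fin m) →
  length (filter P? (List.tabulate f)) ≡ count (P? ∘ f)
length-filter-tabulate {n = ℕ.zero}  P? f = refl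
length-filter-tabulate {n = ℕ.suc n} P? f with does (P? (f Fin.zero))
... | true  = cong ℕ.suc (length-filter-tabulate P? (f ∘ Fin.suc))
... | false = length-filter-tabulate P? (f ∘ Fin.suc)

length-filter-allFin : ∀ {n} {P : Fin n → Set} (P? : Decidable P) →
  length (filter P? (allFin n)) ≡ count P?
length-filter-allFin P? = length-filter-tabulate P? id

length-++-≤ : ∀ {A : Set} (xs {ys} : List A) {a b c d} →
  length xs ℕ.≤ a ℕ.+ b → length ys ℕ.≤ c ℕ.+ d → length (xs ++ ys) ℕ.≤ (a ℕ.+ c) ℕ.+ (b ℕ.+ d)
length-++-≤ xs {ys} {a} {b} {c} {d} p q = begin
  length (xs ++ ys)             ≡⟨ length-++ xs ⟩
  length xs ℕ.+ length ys       ≤⟨ ℕ.+-mono-≤ p q ⟩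
  (a ℕ.+ b) ℕ.+ (c ℕ.+ d)       ≡⟨ interchange a b c d ⟩
  (a ℕ.+ c) ℕ.+ (b ℕ.+ d)       ∎
  where open ℕ.≤-Reasoning

module _ {A B : Set} {P Q : A → Set} (P? : Decidable P) (Q? : Decidable Q) (g : A → List B) {t d : ℕ}
         (bound : ∀ x → P x → length (g x) ℕ.≤ t ⊎ Q x × length (g x) ℕ.≤ t ℕ.+ d) where

  -- Each element of `P` is charged `t`, and any excess `d` is charged to `Q`. Members of `Q`
  -- outside `P` only enlarge the right side.
  length-concatMap-filter : ∀ xs → length (concatMap g (filter P? xs)) ℕ.≤
    length (filter P? xs) ℕ.* t ℕ.+ length (filter Q? xs) ℕ.* d
  length-concatMap-filter [] = ≤-refl
  length-concatMap-filter (x ∷ xs) with P? x | Q? x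
  ... | no _  | no _  = length-concatMap-filter xs
  ... | no _  | yes _ = ≤-trans (length-concatMap-filter xs) (ℕ.+-monoʳ-≤ (length (filter P? xs) ℕ.* t) (m≤n+m _ d))
  ... | yes p | yes _ = length-++-≤ (g x) {a = t} {d} {length (filter P? xs) ℕ.* t}
    ([ (λ le → ≤-trans le (m≤m+n t d)) , proj₂ ]′ (bound x p)) (length-concatMap-filter xs)
  ... | yes p | no ¬q = length-++-≤ (g x) {a = t} {0} {length (filter P? xs) ℕ.* t}
    ([ (λ le → ≤-trans le (m≤m+n t 0)) , (λ (q , _) → contradiction q ¬q) ]′ (bound x p)) (length-concatMap-filter xs)

length-concatMap-select : ∀ {n} {B : Set} {P Q : Fin n → Set} (P? : Decidable P) (Q? : Decidable Q)
  (g : Fin n → List B) {t d a b} →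
  (∀ x → P x → length (g x) ℕ.≤ t ⊎ Q x × length (g x) ℕ.≤ t ℕ.+ d) →
  count P? ℕ.≤ a → count Q? ℕ.≤ b →
  length (concatMap g (filter P? (allFin n))) ℕ.≤ a ℕ.* t ℕ.+ b ℕ.* d
length-concatMap-select {n} P? Q? g {t} {d} bound p q = ≤-trans
  (length-concatMap-filter P? Q? g bound (allFin n))
  (ℕ.+-mono-≤ (ℕ.*-monoˡ-≤ t (subst (ℕ._≤ _) (sym (length-filter-allFin P?)) p))
              (ℕ.*-monoˡ-≤ d (subst (ℕ._≤ _) (sym (length-filter-allFin Q?)) q)))

module _ {m : ℕ} where
  open DecMembership (_≟_ {m}) using (_∈?_)

  -- If every colour occurred in `xs`, two of them would share a position there by the pigeonhole
  -- principle, and so be equal.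
  fresh-color : (xs : List (Fin m)) → length xs ℕ.< m → ∃ λ γ → γ ∉ xs
  fresh-color xs len<m with any? (λ γ → ¬? (γ ∈? xs))
  ... | yes found = found
  ... | no  none  =
    let i , j , i<j , same = pigeonhole len<m (index ∘ position) in
    contradiction
      (trans (lookup-index (position i)) (trans (cong (List.lookup xs) same) (sym (lookup-index (position j)))))
      (Fin.<⇒≢ i<j)
    where
    position : ∀ γ → γ ∈ xs
    position γ = decidable-stable (γ ∈? xs) (λ γ∉xs → none (γ , γ∉xs))

-- Graphs

adj? : ∀ {n} (G : Graph n) u → Decidable (Adj G u)
adj? G u v = T? (adj G u v)

Adj-sym : ∀ {n} (G : Graph n) {u v} → Adj G u v → Adj G v u
Adj-sym G {u} {v} = subst T (adj-sym G u v)

Adj-irrefl : ∀ {n} (G : Graph n) {v} → ¬ Adj G v v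
Adj-irrefl G {v} = subst T (adj-irrefl G v)

_⊑_ : ∀ {n} → Graph n → Graph n → Set
H ⊑ G = ∀ {u v} → Adj H u v → Adj G u v

degree-mono : ∀ {n} {H G : Graph n} → H ⊑ G → ∀ v → degree H v ℕ.≤ degree G v
degree-mono {H = H} {G} H⊑G v = count-mono (adj? H v) (adj? G v) H⊑G

≤-foldr-⊔ : ∀ {n} (f : Fin n → ℕ) i → f i ℕ.≤ Vector.foldr ℕ._⊔_ 0 f
≤-foldr-⊔ f Fin.zero    = ℕ.m≤m⊔n _ _
≤-foldr-⊔ f (Fin.suc i) = ℕ.m≤n⇒m≤o⊔n (f Fin.zero) (≤-foldr-⊔ (f ∘ Fin.suc) i)

degree≤maxDegree : ∀ {n} (G : Graph n) v → degree G v ℕ.≤ maxDegree G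
degree≤maxDegree G = ≤-foldr-⊔ (degree G)

restrict : ∀ {n} {R : Fin n → Fin n → Set} (G : Graph n) → (∀ u v → Dec (R u v)) →
           (∀ {u v} → R u v → R v u) → Graph n
restrict G R? R-sym = record
  { adj        = λ u v → does (adj? G u v ×-dec R? u v)
  ; adj-sym    = λ u v → does-⇔ (mk⇔ (λ (a , r) → Adj-sym G a , R-sym r) (λ (a , r) → Adj-sym G a , R-sym r))
                   (adj? G u v ×-dec R? u v) (adj? G v u ×-dec R? v u)
  ; adj-irrefl = λ v → dec-false (adj? G v v ×-dec R? v v) (Adj-irrefl G ∘ proj₁)
  }

module _ {n} {R : Fin n → Fin n → Set} (G : Graph n) (R? : ∀ u v → Dec (R u v))
         (R-sym : ∀ {u v} → R u v → R v u) where

  restrict⁻ : ∀ {u v} → Adj (restrict G R? R-sym) u v → Adj G u v × R u v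
  restrict⁻ {u} {v} = does⁻ (adj? G u v ×-dec R? u v)

  restrict⁺ : ∀ {u v} → Adj G u v → R u v → Adj (restrict G R? R-sym) u v
  restrict⁺ {u} {v} a r = does⁺ (adj? G u v ×-dec R? u v) (a , r)

adjacentAt? : ∀ {n} (G : Graph n) → Decidable {A = Fin (n ℕ.* n)} (λ i → T (uncurry (adj G) (remQuot n i)))
adjacentAt? {n} G i = T? (uncurry (adj G) (remQuot n i))

-- Each edge is counted twice, once per orientation; this is only the measure that decreases under
-- deletion.
size : ∀ {n} → Graph n → ℕ
size G = count (adjacentAt? G)

size-strict : ∀ {n} {H G : Graph n} → H ⊑ G → ∀ {u v} → Adj G u v → ¬ Adj H u v → size H ℕ.< size G
size-strict {n} {H} {G} H⊑G {u} {v} uv∈G uv∉H = count-strict (adjacentAt? H) (adjacentAt? G)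
  (combine u v) (λ {i} → H⊑G {proj₁ (remQuot {n} n i)})
  (subst (T ∘ uncurry (adj G)) (sym (remQuot-combine u v)) uv∈G)
  (uv∉H ∘ subst (T ∘ uncurry (adj H)) (remQuot-combine u v))

-- Unordered pairs and edge deletion

SamePair : ∀ {n} → Fin n → Fin n → Fin n → Fin n → Set
SamePair a b x y = (a ≡ x × b ≡ y) ⊎ (a ≡ y × b ≡ x)

module _ {n : ℕ} where

  samePair? : (a b x y : Fin n) → Dec (SamePair a b x y)
  samePair? a b x y = (a ≟ x ×-dec b ≟ y) ⊎-dec (a ≟ y ×-dec b ≟ x)

  samePair-flip : {a b x y : Fin n} → SamePair a b x y → SamePair b a x y
  samePair-flip (inj₁ (p , q)) = inj₂ (q , p)
  samePair-flip (inj₂ (p , q)) = inj₁ (q , p)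

  samePair-sym : {a b x y : Fin n} → SamePair a b x y → SamePair x y a b
  samePair-sym (inj₁ (refl , refl)) = inj₁ (refl , refl)
  samePair-sym (inj₂ (refl , refl)) = inj₂ (refl , refl)

  samePair-trans : {a b x y v w : Fin n} → SamePair a b x y → SamePair x y v w → SamePair a b v w
  samePair-trans (inj₁ (refl , refl)) s = s
  samePair-trans (inj₂ (refl , refl)) s = samePair-flip s

module _ {n} (H : Graph n) (v w : Fin n) where

  private
    R? : ∀ a b → Dec (¬ SamePair a b v w)
    R? a b = ¬? (samePair? a b v w)

    R-sym : ∀ {a b} → ¬ SamePair a b v w → ¬ SamePair b a v w
    R-sym ¬s = ¬s ∘ samePair-flip

  delete : Graph n
  delete = restrict H R? R-sym

  delete⁻ : ∀ {a b} → Adj delete a b → Adj H a b × ¬ SamePair a b v w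
  delete⁻ = restrict⁻ H R? R-sym

  delete⁺ : ∀ {a b} → Adj H a b → ¬ SamePair a b v w → Adj delete a b
  delete⁺ = restrict⁺ H R? R-sym

  delete-⊑ : delete ⊑ H
  delete-⊑ = proj₁ ∘ delete⁻

  size-delete : Adj H v w → size delete ℕ.< size H
  size-delete vw = size-strict {H = delete} {H} delete-⊑ vw (λ a → proj₂ (delete⁻ a) (inj₁ (refl , refl)))

  degree-delete : Adj H v w → degree delete w ℕ.< degree H w
  degree-delete vw = count-strict (adj? delete w) (adj? H w) v delete-⊑ (Adj-sym H vw)
    (λ a → proj₂ (delete⁻ a) (inj₂ (refl , refl)))

-- Deletable edges

module _ {n} (k : ℕ) (H : Graph n) where

  High : Fin n → Set
  High v = k ℕ.< degree H v

  high? : Decidable High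
  high? v = k ℕ.<? degree H v

  highNeighbor? : ∀ v → Decidable (λ x → Adj H v x × High x)
  highNeighbor? v x = adj? H v x ×-dec high? x

  record Deletable (v w : Fin n) : Set where
    constructor deletable
    field
      edge∈H    : Adj H v w
      low       : degree H w ℕ.≤ k
      few-highs : count (highNeighbor? v) ℕ.≤ k

  deletable-exists : ∀ {G} → Degenerate k G → H ⊑ G → ∀ {a b} → Adj H a b → ∃₂ Deletable
  deletable-exists {G} degen H⊑G {a} {b} ab with any? high?
  -- The high vertices span no nonempty subgraph here, but both ends of any edge have degree at most
  -- `k`.
  ... | no none = a , b , deletable ab (≮⇒≥ (none ∘ (b ,_)))
    (≤-trans (count-mono (highNeighbor? a) (adj? H a) proj₁) (≮⇒≥ (none ∘ (a ,_))))
  ... | yes (u , u-high) = v , w , deletable vw (≮⇒≥ w-low)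
      -- Since `v` is high, its high neighbours in `H` are neighbours in `core`.
      (≤-trans (count-mono (highNeighbor? v) (adj? core v) (λ (vx , x-high) → core⁺ vx (v-high , x-high))) v-deg)
    where
    R? : ∀ x y → Dec (High x × High y)
    R? x y = high? x ×-dec high? y

    R-sym : ∀ {x y} → High x × High y → High y × High x
    R-sym (p , q) = q , p

    core : Graph n
    core = restrict H R? R-sym

    core⁺ : ∀ {x y} → Adj H x y → High x × High y → Adj core x y
    core⁺ = restrict⁺ H R? R-sym

    lowDegreeVertex : ∃ λ v → v ∈ₛ select high? × degree core v ℕ.≤ k
    lowDegreeVertex = degen
      (record
        { vertices = select high?
        ; graph    = core
        ; endpoint = ∈-select⁺ high? ∘ proj₁ ∘ proj₂ ∘ restrict⁻ H R? R-sym
        ; included = H⊑G ∘ proj₁ ∘ restrict⁻ H R? R-sym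
        })
      (u , ∈-select⁺ high? u-high)

    v : Fin n
    v = proj₁ lowDegreeVertex

    v-high : High v
    v-high = ∈-select⁻ high? (proj₁ (proj₂ lowDegreeVertex))

    v-deg : degree core v ℕ.≤ k
    v-deg = proj₂ (proj₂ lowDegreeVertex)

    -- If all `H`-neighbours of `v` were high, its degree in `core` would equal its degree in `H`,
    -- which exceeds `k`.
    lowNeighbor : ∃ λ w → Adj H v w × ¬ High w
    lowNeighbor with any? (λ w → adj? H v w ×-dec ¬? (high? w))
    ... | yes found = found
    ... | no  none  = contradiction v-high (ℕ.≤⇒≯ (≤-trans (count-mono (adj? H v) (adj? core v) inCore) v-deg))
      where
      inCore : ∀ {x} → Adj H v x → Adj core v x
      inCore {x} vx = core⁺ vx (v-high , decidable-stable (high? x) (λ x-low → none (x , vx , x-low)))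

    w : Fin n
    w = proj₁ lowNeighbor

    vw : Adj H v w
    vw = proj₁ (proj₂ lowNeighbor)

    w-low : ¬ High w
    w-low = proj₂ (proj₂ lowNeighbor)

-- The invariant on heavy neighbours

module _ {n} (k : ℕ) (G : Graph n) where

  -- The degree threshold is one below that of `High`, so that a vertex of degree at most `k` falls
  -- under it on losing an edge.
  Heavy : Graph n → Fin n → Fin n → Set
  Heavy H u x = Adj G u x × (Adj H u x ⊎ k ℕ.≤ degree H x)

  heavy? : ∀ H u → Decidable (Heavy H u)
  heavy? H u x = adj? G u x ×-dec (adj? H u x ⊎-dec (k ℕ.≤? degree H x))

  -- The second alternative survives at `u` until an edge with low end `u` is deleted; from then on
  -- the first holds, since deletions never create heavy neighbours.
  HeavyBound : Graph n → Set
  HeavyBound H = ∀ u → count (heavy? H u) ℕ.≤ k ⊎ (∀ {x} → Heavy H u x → Adj H u x)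

  heavyBound-initial : HeavyBound G
  heavyBound-initial u = inj₂ proj₁

  -- If all heavy neighbours are `H`-neighbours, the degree of `w` in `H` bounds their number.
  heavy-low : ∀ {H} → HeavyBound H → ∀ {w} → degree H w ℕ.≤ k → count (heavy? H w) ℕ.≤ k
  heavy-low {H} bound {w} low with bound w
  ... | inj₁ few   = few
  ... | inj₂ all∈H = ≤-trans (count-mono (heavy? H w) (adj? H w) all∈H) low

  heavyBound-delete : ∀ {H v w} → Deletable k H v w → HeavyBound H → HeavyBound (delete H v w)
  heavyBound-delete {H} {v} {w} (deletable vw low _) bound u = preserve (u ≟ w) (bound u)
    where
    H′ : Graph n
    H′ = delete H v w

    shrink : ∀ {u x} → Heavy H′ u x → Heavy H u x
    shrink {x = x} (ux , why) = ux ,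
      Sum.map (delete-⊑ H v w) (λ le → ≤-trans le (degree-mono {H = H′} {H} (delete-⊑ H v w) x)) why

    preserve : Dec (u ≡ w) → count (heavy? H u) ℕ.≤ k ⊎ (∀ {x} → Heavy H u x → Adj H u x) →
               count (heavy? H′ u) ℕ.≤ k ⊎ (∀ {x} → Heavy H′ u x → Adj H′ u x)
    preserve _ (inj₁ few) = inj₁ (≤-trans (count-mono (heavy? H′ u) (heavy? H u) shrink) few)
    preserve (yes refl) (inj₂ _) =
      inj₁ (≤-trans (count-mono (heavy? H′ u) (heavy? H u) shrink) (heavy-low {H} bound low))
    preserve (no u≢w) (inj₂ all∈H) = inj₂ λ
      { (_  , inj₁ ux∈H′) → ux∈H′
      ; (ux , inj₂ k≤deg) → delete⁺ H v w (all∈H (shrink (ux , inj₂ k≤deg))) λ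
        -- The edge lost at `u` would lead to `w`, whose degree has just dropped below `k`.
        { (inj₁ (_ , refl)) → ℕ.<⇒≱ (<-≤-trans (degree-delete H v w vw) low) k≤deg
        ; (inj₂ (u≡w , _))  → u≢w u≡w
        }
      }

  nearHigh? : ∀ H v → Decidable (λ x → Adj G v x × High k H x)
  nearHigh? H v x = adj? G v x ×-dec high? k H x

  -- High neighbours are heavy. By the invariant they are at most `k`, or they are all
  -- `H`-neighbours and `few-highs` applies.
  few-high-neighbors : ∀ {H} → HeavyBound H → ∀ {v w} → Deletable k H v w →
    count (nearHigh? H v) ℕ.≤ k
  few-high-neighbors {H} bound {v} (deletable _ _ few-highs) with bound v
  ... | inj₁ few   = ≤-trans
    (count-mono (nearHigh? H v) (heavy? H v) (λ (vx , x-high) → vx , inj₂ (<⇒≤ x-high))) few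
  ... | inj₂ all∈H = ≤-trans
    (count-mono (nearHigh? H v) (highNeighbor? k H v) (λ (vx , x-high) → all∈H (vx , inj₂ (<⇒≤ x-high)) , x-high)) few-highs

-- Greedy colouring

module _ {n} (G : Graph n) where

  -- Edges are coloured as ordered pairs, symmetrically, so a conflict may be
  -- assumed to be witnessed by the first endpoints.
  record Coloring (m : ℕ) (H : Graph n) : Set where
    field
      color     : Fin n → Fin n → Fin m
      color-sym : ∀ a b → color a b ≡ color b a
      proper    : ∀ {a b x y} → Adj H a b → Adj H x y → a ≡ x ⊎ Adj G a x →
                  ¬ SamePair a b x y → color a b ≢ color x y

  otherNeighbor? : ∀ v w → Decidable (λ x → Adj G v x × x ≢ w)
  otherNeighbor? v w x = adj? G v x ×-dec ¬? (x ≟ w)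

  -- Here `Δ` is one less than the degree bound; the excluded `w` makes up the difference.
  otherNeighbors : ∀ {v w Δ} → Adj G v w → degree G v ℕ.≤ ℕ.suc Δ → count (otherNeighbor? v w) ℕ.≤ Δ
  otherNeighbors {v} {w} vw deg≤ = ℕ.s≤s⁻¹ (<-≤-trans
    (count-strict (otherNeighbor? v w) (adj? G v) w proj₁ vw (λ (_ , w≢w) → w≢w refl)) deg≤)

  module _ {m} (H : Graph n) (c : Fin n → Fin n → Fin m) where

    colorsAt : Fin n → List (Fin m)
    colorsAt x = map (c x) (filter (adj? H x) (allFin n))

    -- No listed vertex is `v` or `w`, so the edge between them contributes no entry even when `H`
    -- contains it.
    colorsNear : Fin n → Fin n → List (Fin m)
    colorsNear v w = concatMap colorsAt (filter (otherNeighbor? v w) (allFin n))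

    length-colorsAt : ∀ x → length (colorsAt x) ≡ degree H x
    length-colorsAt x = trans (length-map (c x) (filter (adj? H x) (allFin n))) (length-filter-allFin (adj? H x))

    ∈-colorsNear : ∀ {v w x y} → Adj G v x → x ≢ w → Adj H x y → c x y ∈ colorsNear v w
    ∈-colorsNear {v} {w} {x} {y} vx x≢w xy = ∈-concatMap⁺ colorsAt
      (lose (∈-filter⁺ (otherNeighbor? v w) (∈-allFin x) (vx , x≢w))
            (∈-map⁺ (c x) (∈-filter⁺ (adj? H x) (∈-allFin y) xy)))

    module _ (c-sym : ∀ a b → c a b ≡ c b a) (H⊑G : H ⊑ G) where

      -- An edge at `v` is listed at its far end `y`, a `G`-neighbour of `v`, so edges at `v` add
      -- nothing to the count.
      ∈-colorsNear-incident : ∀ {v w y} → Adj H v y → y ≢ w → c v y ∈ colorsNear v w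
      ∈-colorsNear-incident {v} {w} {y} vy y≢w =
        subst (_∈ colorsNear v w) (c-sym y v) (∈-colorsNear (H⊑G vy) y≢w (Adj-sym H vy))

      conflict⇒∈ : ∀ v w {x y} → Adj H x y → v ≡ x ⊎ Adj G v x → ¬ SamePair x y v w →
                   c x y ∈ colorsNear v w ⊎ c x y ∈ colorsNear w v
      conflict⇒∈ v w xy (inj₁ refl) diff =
        inj₁ (∈-colorsNear-incident xy (λ y≡w → diff (inj₁ (refl , y≡w))))
      conflict⇒∈ v w {x} xy (inj₂ vx) diff with x ≟ w
      ... | no x≢w   = inj₁ (∈-colorsNear vx x≢w xy)
      -- The edge starts at `w`, so it is listed near `w` at its far end, which is not `v`.
      ... | yes refl = inj₂ (∈-colorsNear-incident xy (λ y≡v → diff (inj₂ (refl , y≡v))))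

  extend : ∀ {m H v w} → H ⊑ G → (C : Coloring m (delete H v w)) → let open Coloring C in
    length (colorsNear H color w v ++ colorsNear H color v w) ℕ.< m → Coloring m H
  extend {m} {H} {v} {w} H⊑G C room = record
    { color     = color′
    ; color-sym = color′-sym
    ; proper    = proper′
    }
    where
    open Coloring C

    forbidden : List (Fin m)
    forbidden = colorsNear H color w v ++ colorsNear H color v w

    γ : Fin m
    γ = proj₁ (fresh-color forbidden room)

    γ∉ : γ ∉ forbidden
    γ∉ = proj₂ (fresh-color forbidden room)

    color′ : Fin n → Fin n → Fin m
    color′ a b = if does (samePair? a b v w) then γ else color a b

    color′-sym : ∀ a b → color′ a b ≡ color′ b a
    color′-sym a b = cong₂ (if_then γ else_)
      (does-⇔ (mk⇔ samePair-flip samePair-flip) (samePair? a b v w) (samePair? b a v w)) (color-sym a b)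

    -- The conflict may be witnessed at either end of the new edge; exchanging the ends exchanges
    -- the two halves of `forbidden`.
    γ-fresh : ∀ {a b x y} → SamePair a b v w → Adj H x y → a ≡ x ⊎ Adj G a x →
              ¬ SamePair x y v w → γ ≢ color x y
    γ-fresh (inj₁ (refl , refl)) xy near diff eq = γ∉ (subst (_∈ forbidden) (sym eq)
      ([ ∈-++⁺ʳ (colorsNear H color w v) , ∈-++⁺ˡ ]′ (conflict⇒∈ H color color-sym H⊑G v w xy near diff)))
    γ-fresh (inj₂ (refl , refl)) xy near diff eq = γ∉ (subst (_∈ forbidden) (sym eq)
      ([ ∈-++⁺ˡ , ∈-++⁺ʳ (colorsNear H color w v) ]′
        (conflict⇒∈ H color color-sym H⊑G w v xy near (diff ∘ Sum.swap))))

    proper′ : ∀ {a b x y} → Adj H a b → Adj H x y → a ≡ x ⊎ Adj G a x →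
              ¬ SamePair a b x y → color′ a b ≢ color′ x y
    proper′ {a} {b} {x} {y} ab xy near diff = cases (samePair? a b v w) (samePair? x y v w)
      where
      -- Abstracting over both decisions lets the conditionals in `color′` reduce.
      cases : (p? : Dec (SamePair a b v w)) (q? : Dec (SamePair x y v w)) →
              (if does p? then γ else color a b) ≢ (if does q? then γ else color x y)
      cases (yes p) (yes q) = contradiction (samePair-trans p (samePair-sym q)) diff
      cases (yes p) (no ¬q) = γ-fresh p xy near ¬q
      cases (no ¬p) (yes q) = γ-fresh q ab (Sum.map sym (Adj-sym G) near) ¬p ∘ sym
      cases (no ¬p) (no ¬q) = proper (delete⁺ H v w ab ¬p) (delete⁺ H v w xy ¬q) near diff

  -- From colourings of ordered pairs to strong edge colourings

  stronglyColorable : ∀ {m} → Coloring m G → StronglyColorable G m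
  stronglyColorable C = edgeColor , strong
    where
    open Coloring C

    edgeColor : Edge G → _
    edgeColor e = color (src e) (tgt e)

    -- The endpoint witnessing a conflict is moved to the first position, as `proper` requires.
    orient : ∀ {u} (e : Edge G) → Incident u e →
      ∃ λ b → Adj G u b × SamePair u b (src e) (tgt e) × color u b ≡ edgeColor e
    orient e (inj₁ refl) = tgt e , adjacent e , inj₁ (refl , refl) , refl
    orient e (inj₂ refl) = src e , Adj-sym G (adjacent e) , inj₂ (refl , refl) , color-sym _ _

    samePair⇒≡ : ∀ (e f : Edge G) → SamePair (src e) (tgt e) (src f) (tgt f) → e ≡ f
    samePair⇒≡ e f (inj₁ (p , q)) = code-injective e f (cong₂ combine p q)
    -- Swapped ends are impossible because both edges list their ends in increasing order.
    samePair⇒≡ e f (inj₂ (p , q)) =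
      contradiction (subst₂ Fin._<_ p q (src<tgt e)) (Fin.<-asym (src<tgt f))

    separate : ∀ {u v} (e f : Edge G) → e ≢ f → Incident u e → Incident v f → u ≡ v ⊎ Adj G u v →
               edgeColor e ≢ edgeColor f
    separate e f e≢f u∈e v∈f near eq =
      let _ , ub , same-e , color-e = orient e u∈e
          _ , vd , same-f , color-f = orient f v∈f
      in proper ub vd near
           (λ same → e≢f (samePair⇒≡ e f (samePair-trans (samePair-sym same-e) (samePair-trans same same-f))))
           (trans color-e (trans eq (sym color-f)))

    strong : IsStrongEdgeColoring edgeColor
    strong e f e≢f (inj₁ (_ , u∈e , u∈f))          = separate e f e≢f u∈e u∈f (inj₁ refl)
    strong e f e≢f (inj₂ (_ , _ , u∈e , v∈f , uv)) = separate e f e≢f u∈e v∈f (inj₂ uv)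

-- Bounding the forbidden colours

-- The degeneracy is k = j + 1 and the maximum degree is Δ = k + d.
conflicts : ℕ → ℕ → ℕ
conflicts j d = ((j ℕ.+ d) ℕ.* j ℕ.+ j ℕ.* ℕ.suc d) ℕ.+ ((j ℕ.+ d) ℕ.* ℕ.suc j ℕ.+ ℕ.suc j ℕ.* d)

module _ {n} (j d : ℕ) (G : Graph n) (degen : Degenerate (ℕ.suc j) G)
         (degree≤ : ∀ v → degree G v ℕ.≤ ℕ.suc j ℕ.+ d) where

  module _ {m} {H : Graph n} (H⊑G : H ⊑ G) (bound : HeavyBound (ℕ.suc j) G H)
           {v w} (del : Deletable (ℕ.suc j) H v w) (c : Fin n → Fin n → Fin m) where

    open Deletable del

    private
      k : ℕ
      k = ℕ.suc j

      colorsAt≤ : ∀ x → length (colorsAt G H c x) ℕ.≤ k ℕ.+ d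
      colorsAt≤ x = subst (ℕ._≤ k ℕ.+ d) (sym (length-colorsAt G H c x))
        (≤-trans (degree-mono {H = H} {G} H⊑G x) (degree≤ x))

    -- At most Δ - 1 = `j + d` neighbours are charged k - 1 = `j` each; `suc d` = Δ - (k - 1) is the
    -- excess allowed to a heavy one.
    length-colorsNear-low : length (colorsNear G H c w v) ℕ.≤ (j ℕ.+ d) ℕ.* j ℕ.+ j ℕ.* ℕ.suc d
    length-colorsNear-low = length-concatMap-select (otherNeighbor? G w v) otherHeavy? (colorsAt G H c) split
      (otherNeighbors G (H⊑G (Adj-sym H edge∈H)) (degree≤ w))
      -- As an `H`-neighbour of `w`, `v` is itself heavy, which leaves at most k - 1 others.
      (ℕ.s≤s⁻¹ (<-≤-trans
        (count-strict otherHeavy? (heavy? k G H w) v proj₁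
          (H⊑G (Adj-sym H edge∈H) , inj₁ (Adj-sym H edge∈H)) (λ (_ , v≢v) → v≢v refl))
        (heavy-low k G {H} bound low)))
      where
      otherHeavy? : Decidable (λ x → Heavy k G H w x × x ≢ v)
      otherHeavy? x = heavy? k G H w x ×-dec ¬? (x ≟ v)

      split : ∀ x → Adj G w x × x ≢ v → length (colorsAt G H c x) ℕ.≤ j ⊎
              (Heavy k G H w x × x ≢ v) × length (colorsAt G H c x) ℕ.≤ j ℕ.+ ℕ.suc d
      split x (wx , x≢v) with k ℕ.≤? degree H x
      ... | yes k≤deg = inj₂ (((wx , inj₂ k≤deg) , x≢v) ,
                              ≤-trans (colorsAt≤ x) (≤-reflexive (sym (ℕ.+-suc j d))))
      ... | no  k≰deg = inj₁ (subst (ℕ._≤ j) (sym (length-colorsAt G H c x)) (ℕ.s≤s⁻¹ (ℕ.≰⇒> k≰deg)))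

    -- Each neighbour is charged `k`; `d` = Δ - k is the excess allowed to a high one, and at most
    -- `k` are high.
    length-colorsNear-high : length (colorsNear G H c v w) ℕ.≤ (j ℕ.+ d) ℕ.* k ℕ.+ k ℕ.* d
    length-colorsNear-high = length-concatMap-select (otherNeighbor? G v w)
      (nearHigh? k G H v) (colorsAt G H c) split
      (otherNeighbors G (H⊑G edge∈H) (degree≤ v)) (few-high-neighbors k G bound del)
      where
      split : ∀ x → Adj G v x × x ≢ w → length (colorsAt G H c x) ℕ.≤ k ⊎
              (Adj G v x × High k H x) × length (colorsAt G H c x) ℕ.≤ k ℕ.+ d
      split x (vx , _) with high? k H x
      ... | yes x-high = inj₂ ((vx , x-high) , colorsAt≤ x)
      ... | no  x-low  = inj₁ (subst (ℕ._≤ k) (sym (length-colorsAt G H c x)) (≮⇒≥ x-low))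

    length-forbidden : length (colorsNear G H c w v ++ colorsNear G H c v w) ℕ.≤ conflicts j d
    length-forbidden = subst (ℕ._≤ conflicts j d) (sym (length-++ (colorsNear G H c w v)))
      (ℕ.+-mono-≤ length-colorsNear-low length-colorsNear-high)

  greedy : ∀ H → Acc ℕ._<_ (size H) → H ⊑ G → HeavyBound (ℕ.suc j) G H → Coloring G (ℕ.suc (conflicts j d)) H
  greedy H (acc rec) H⊑G bound with any? (λ a → any? (adj? H a))
  -- An edgeless `H` accepts a constant colouring; `Fin.zero` exists because the number of colours
  -- is a successor.
  ... | no none = record
    { color     = λ _ _ → Fin.zero
    ; color-sym = λ _ _ → refl
    ; proper    = λ ab _ _ _ _ → none (_ , _ , ab)
    }
  ... | yes (_ , _ , ab) =
    let v , w , del = deletable-exists (ℕ.suc j) H degen H⊑G ab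
        -- The remaining edges are coloured first, so an edge meets conflicts only with edges
        -- deleted after it.
        C = greedy (delete H v w) (rec (size-delete H v w (Deletable.edge∈H del)))
              (H⊑G ∘ delete-⊑ H v w) (heavyBound-delete (ℕ.suc j) G del bound)
    in extend G H⊑G C (ℕ.s≤s (length-forbidden H⊑G bound del (Coloring.color C)))

  strongChromaticIndex≤ : strongChromaticIndex G ℕ.≤ ℕ.suc (conflicts j d)
  strongChromaticIndex≤ = proj₂ (strongChromaticIndex-correct G) _
    (stronglyColorable G (greedy G (<-wellFounded (size G)) id (heavyBound-initial (ℕ.suc j) G)))

-- The cast to ℤ commutes with sums by computation and with products by `pos-*`. A polynomial
-- identity remains, in which the square appears unfolded.
conflicts-ℤ : ∀ j d → let k = + ℕ.suc j; Δ = + (ℕ.suc j ℕ.+ d) in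
  + ℕ.suc (conflicts j d) ≡ ((+ 4) * k - (+ 2)) * Δ - (+ 2) * (k ^ 2) + (+ 1)
conflicts-ℤ j d = trans
  (cong (λ z → + 1 + z) (cong₂ _+_
    (cong₂ _+_ (pos-* (j ℕ.+ d) j) (pos-* j (ℕ.suc d)))
    (cong₂ _+_ (pos-* (j ℕ.+ d) (ℕ.suc j)) (pos-* (ℕ.suc j) d))))
  (identity (+ j) (+ d))
  where
  identity : ∀ (j d : ℤ) →
    + 1 + (((j + d) * j + j * (+ 1 + d)) + ((j + d) * (+ 1 + j) + (+ 1 + j) * d)) ≡
    ((+ 4) * (+ 1 + j) - (+ 2)) * ((+ 1 + j) + d) - (+ 2) * ((+ 1 + j) * ((+ 1 + j) * + 1)) + (+ 1)
  identity = solve-∀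

theorem1 : ∀ (n k : ℕ) (G : Graph n) → 1 ℕ.≤ k → Degenerate k G → k ℕ.≤ maxDegree G →
    + strongChromaticIndex G ≤ ((+ 4) * (+ k) - (+ 2)) * (+ maxDegree G) - (+ 2) * ((+ k) ^ 2) + (+ 1)
theorem1 n (ℕ.suc j) G _ degen k≤Δ = subst
  (λ Δ → + strongChromaticIndex G ≤ ((+ 4) * (+ ℕ.suc j) - (+ 2)) * (+ Δ) - (+ 2) * ((+ ℕ.suc j) ^ 2) + (+ 1))
  Δ≡
  (subst (+ strongChromaticIndex G ≤_) (conflicts-ℤ j d) (+≤+ (strongChromaticIndex≤ j d G degen degree≤)))
  where
  -- The truncated subtraction is exact because of `k≤Δ`.
  d : ℕ
  d = maxDegree G ℕ.∸ ℕ.suc j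

  Δ≡ : ℕ.suc j ℕ.+ d ≡ maxDegree G
  Δ≡ = ℕ.m+[n∸m]≡n k≤Δ

  degree≤ : ∀ v → degree G v ℕ.≤ ℕ.suc j ℕ.+ d
  degree≤ v = subst (degree G v ℕ.≤_) (sym Δ≡) (degree≤maxDegree G v)
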